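{- Let $d\ge1$ and let $V$ be either $(\mathbb R^d,\|\cdot\|_\infty)$ or a $d$-dimensional real inner-product space. Let $U$ be an abelian group with a translation-invariant ultrametric, let $\Lambda\subset V\times U$ be a closed additive subgroup, and let $X=(V\times U)/\Lambda$ carry the quotient metric induced by the maximum product metric. Let $\alpha\in X$ have strict best-return denominators $q_1<q_2<\cdots$ with record distances $r_n=\rho(q_n)$, and let $n\ge1$ be such that $q_{n+P(V)}$ is defined. If $q_n\alpha$ has a representative $e_0=(v_0,u_0)\in V\times U$ such that $$\max\{\|v_0\|_V,|u_0|_U\}=r_n,\qquad |u_0|_U<r_n,$$ then $$q_{n+P(V)}\ge q_n+q_{n+1}.$$
   Context: Metric setting. Write the ultrametric on $U$ as $d_U(u,w)=|u-w|_U$, so $|u+w|_U\le\max\{|u|_U,|w|_U\}$. On $V\times U$ put $|(v,u)|=\max\{\|v\|_V,|u|_U\}$; "closed" refers to the induced metric topology. On $X=(V\times U)/\Lambda$ put $\|a+\Lambda\|_X=\inf_{\lambda\in\Lambda}|a-\lambda|$ and $d_X(x,y)=\|x-y\|_X$. A representative of $x\in X$ is an element of the coset $x$. Best returns. For positive integers $q$ put $\rho(q)=d_X(q\alpha,0)$. The strict best-return denominators of $\alpha$ are $q_1=1$ and $q_{n+1}=\min\{q>q_n:\rho(q)<\rho(q_n)\}$ as long as such $q$ exists; the sequence may terminate, and a zero return (if any) is retained as its final term. Packing number. $P(V)$ is the maximal cardinality of a set $S\subset\{v\in V:\|v\|_V<1\}$ (open unit ball) with $\|v-w\|_V\ge1$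 for all distinct $v,w\in S$. This maximum is finite. -}

module Defs where

open import Algebra.Bundles using (AbelianGroup; CommutativeRing; Group)
open import Algebra.Module.Bundles using (Module)
open import Algebra.Structures using (IsCommutativeRing)
import Algebra.Construct.DirectProduct as DirectProduct
import Algebra.Construct.NaturalChoice.Max as Max
import Algebra.Definitions.RawMonoid as RawMonoidDefinitions
import Algebra.Module.Construct.TensorUnit as TensorUnit
import Algebra.Properties.AbelianGroup as AbelianGroupProperties
open import Data.Fin.Base using (Fin)
open import Data.Nat.Base as ℕ using (ℕ; suc)
open import Data.Product.Base using (∃; ∃-syntax; Σ-syntax; _×_; _,_; proj₁; proj₂)
open import Data.Vec.Functional as Vector using (Vector)
open import Function.Metric.Definitions using (TranslationInvariant)
open import Function.Metric.Structures using (IsGeneralMetric)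
open import Level using (Level; Setω; 0ℓ; _⊔_) renaming (suc to lsuc)
open import Relation.Binary.Bundles using (DecTotalOrder)
open import Relation.Binary.Core using (Rel)
import Relation.Binary.Construct.NonStrictToStrict as Strict
open import Relation.Binary.PropositionalEquality.Core using (_≡_; _≢_)
open import Relation.Binary.Structures using (IsDecTotalOrder)
open import Relation.Nullary.Negation.Core using (¬_)
open import Relation.Unary using (Pred; Satisfiable; ∁)

module Bounds {a ℓ} {A : Set a} (_≤_ : Rel A ℓ) where

  UpperBound LowerBound : ∀ {p} → Pred A p → A → Set (a ⊔ ℓ ⊔ p)
  UpperBound S b = ∀ {x} → S x → x ≤ b
  LowerBound S b = ∀ {x} → S x → b ≤ x

  IsSupremum IsInfimum : ∀ {p} → Pred A p → A → Set (a ⊔ ℓ ⊔ p)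
  IsSupremum S s = UpperBound S s × (∀ {b} → UpperBound S b → s ≤ b)
  IsInfimum  S s = LowerBound S s × (∀ {b} → LowerBound S b → b ≤ s)

-- The real numbers are characterised, up to unique isomorphism, as the
-- Dedekind-complete ordered field.  The order is decidable, as it is
-- classically.
record CompleteOrderedField : Setω where
  infix  8 -_
  infixl 7 _*_
  infixl 6 _+_
  infix  4 _≈_ _≤_
  field
    Carrier           : Set
    _≈_ _≤_           : Rel Carrier 0ℓ
    _+_ _*_           : Carrier → Carrier → Carrier
    -_                : Carrier → Carrier
    0# 1#             : Carrier
    isCommutativeRing : IsCommutativeRing _≈_ _+_ _*_ -_ 0# 1#
    isDecTotalOrder   : IsDecTotalOrder _≈_ _≤_
    0≉1               : ¬ (0# ≈ 1#)
    invertible        : ∀ x → ¬ (x ≈ 0#) → ∃[ y ] x * y ≈ 1#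
    +-monoˡ-≤         : ∀ z {x y} → x ≤ y → x + z ≤ y + z
    *-nonNegative     : ∀ {x y} → 0# ≤ x → 0# ≤ y → 0# ≤ x * y

  open Bounds _≤_ public

  field
    complete : ∀ {p} (S : Pred Carrier p) →
               Satisfiable S → Satisfiable (UpperBound S) →
               ∃ (IsSupremum S)

  commutativeRing : CommutativeRing 0ℓ 0ℓ
  commutativeRing = record { isCommutativeRing = isCommutativeRing }

  decTotalOrder : DecTotalOrder 0ℓ 0ℓ 0ℓ
  decTotalOrder = record { isDecTotalOrder = isDecTotalOrder }

  open Strict _≈_ _≤_ public using (_<_)
  open Max (DecTotalOrder.totalOrder decTotalOrder) public
    using (x≤y⊔x) renaming (_⊔_ to max)

  ∣_∣ : Carrier → Carrier
  ∣ x ∣ = max x (- x)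

  inf : ∀ {p} (S : Pred Carrier p) →
        Satisfiable S → Satisfiable (LowerBound S) → Carrier
  inf S (x , x∈S) bounded =
    proj₁ (complete (LowerBound S) bounded (x , λ b≤S → b≤S x∈S))

  inf-isInfimum : ∀ {p} (S : Pred Carrier p) nonempty bounded →
                  IsInfimum S (inf S nonempty bounded)
  inf-isInfimum S (x , x∈S) bounded =
    (λ y∈S → proj₂ sup (λ b≤S → b≤S y∈S)) , λ b≤S → proj₁ sup b≤S
    where
    sup = proj₂ (complete (LowerBound S) bounded (x , λ b≤S → b≤S x∈S))

record IsSubgroup {g ℓ p} (G : AbelianGroup g ℓ)
                  (H : Pred (AbelianGroup.Carrier G) p) : Set (g ⊔ ℓ ⊔ p) where
  open AbelianGroup G
  field
    resp      : ∀ {x y} → x ≈ y → H x → H y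
    ε-closed  : H ε
    ∙-closed  : ∀ {x y} → H x → H y → H (x ∙ y)
    ⁻¹-closed : ∀ {x} → H x → H (x ⁻¹)

-- A coset is represented by any of its elements, with equality in the
-- quotient identifying x and y when x − y lies in the subgroup.
module _ {g ℓ p} (G : AbelianGroup g ℓ)
         {H : Pred (AbelianGroup.Carrier G) p} (isSubgroup : IsSubgroup G H) where

  open AbelianGroup G
  open Group group using (_//_)
  open AbelianGroupProperties G using (⁻¹-∙-comm; ⁻¹-involutive)
  open IsSubgroup isSubgroup
  open import Relation.Binary.Reasoning.Setoid setoid

  private
    _∼_ : Rel Carrier p
    x ∼ y = H (x // y)

    ≈⇒∼ : ∀ {x y} → x ≈ y → x ∼ y
    ≈⇒∼ {x} {y} x≈y =
      resp (sym (trans (∙-congʳ x≈y) (inverseʳ y))) ε-closed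

    ∼-sym : ∀ {x y} → x ∼ y → y ∼ x
    ∼-sym {x} {y} x∼y = resp (begin
      (x // y) ⁻¹       ≈⟨ ⁻¹-∙-comm x (y ⁻¹) ⟨
      x ⁻¹ ∙ (y ⁻¹) ⁻¹  ≈⟨ ∙-congˡ (⁻¹-involutive y) ⟩
      x ⁻¹ ∙ y          ≈⟨ comm (x ⁻¹) y ⟩
      y // x            ∎) (⁻¹-closed x∼y)

    ∼-trans : ∀ {x y z} → x ∼ y → y ∼ z → x ∼ z
    ∼-trans {x} {y} {z} x∼y y∼z = resp (begin
      (x // y) ∙ (y // z)         ≈⟨ assoc x (y ⁻¹) (y // z) ⟩
      x ∙ (y ⁻¹ ∙ (y // z))       ≈⟨ ∙-congˡ (assoc (y ⁻¹) y (z ⁻¹)) ⟨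
      x ∙ (y ⁻¹ ∙ y ∙ z ⁻¹)       ≈⟨ ∙-congˡ (∙-congʳ (inverseˡ y)) ⟩
      x ∙ (ε ∙ z ⁻¹)              ≈⟨ ∙-congˡ (identityˡ (z ⁻¹)) ⟩
      x // z                      ∎) (∙-closed x∼y y∼z)

    ∙-cong-∼ : ∀ {x y u v} → x ∼ y → u ∼ v → (x ∙ u) ∼ (y ∙ v)
    ∙-cong-∼ {x} {y} {u} {v} x∼y u∼v = resp (begin
      (x // y) ∙ (u // v)         ≈⟨ assoc x (y ⁻¹) (u // v) ⟩
      x ∙ (y ⁻¹ ∙ (u ∙ v ⁻¹))     ≈⟨ ∙-congˡ (assoc (y ⁻¹) u (v ⁻¹)) ⟨
      x ∙ (y ⁻¹ ∙ u ∙ v ⁻¹)       ≈⟨ ∙-congˡ (∙-congʳ (comm (y ⁻¹) u)) ⟩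
      x ∙ (u ∙ y ⁻¹ ∙ v ⁻¹)       ≈⟨ ∙-congˡ (assoc u (y ⁻¹) (v ⁻¹)) ⟩
      x ∙ (u ∙ (y ⁻¹ ∙ v ⁻¹))     ≈⟨ assoc x u (y ⁻¹ ∙ v ⁻¹) ⟨
      x ∙ u ∙ (y ⁻¹ ∙ v ⁻¹)       ≈⟨ ∙-congˡ (⁻¹-∙-comm y v) ⟩
      (x ∙ u) // (y ∙ v)          ∎) (∙-closed x∼y u∼v)

    ⁻¹-cong-∼ : ∀ {x y} → x ∼ y → (x ⁻¹) ∼ (y ⁻¹)
    ⁻¹-cong-∼ {x} {y} x∼y = resp (sym (⁻¹-∙-comm x (y ⁻¹))) (⁻¹-closed x∼y)

  _/_ : AbelianGroup g p
  _/_ = record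
    { Carrier = Carrier
    ; _≈_     = _∼_
    ; _∙_     = _∙_
    ; ε       = ε
    ; _⁻¹     = _⁻¹
    ; isAbelianGroup = record
      { isGroup = record
        { isMonoid = record
          { isSemigroup = record
            { isMagma = record
              { isEquivalence = record
                { refl = ≈⇒∼ refl ; sym = ∼-sym ; trans = ∼-trans }
              ; ∙-cong = ∙-cong-∼
              }
            ; assoc = λ x y z → ≈⇒∼ (assoc x y z)
            }
          ; identity = (λ x → ≈⇒∼ (identityˡ x)) , (λ x → ≈⇒∼ (identityʳ x))
          }
        ; inverse = (λ x → ≈⇒∼ (inverseˡ x)) , (λ x → ≈⇒∼ (inverseʳ x))
        ; ⁻¹-cong = ⁻¹-cong-∼
        }
      ; comm = λ x y → ≈⇒∼ (comm x y)
      }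
    }

module Geometry (ℝ : CompleteOrderedField) where

  module ℝ = CompleteOrderedField ℝ
  open ℝ using (0#; 1#; max; _<_) renaming (Carrier to R; ∣_∣ to abs)

  VectorSpace : Set₁
  VectorSpace = Module ℝ.commutativeRing 0ℓ 0ℓ

  module _ (M : VectorSpace) where
    open Module M
    open RawMonoidDefinitions +ᴹ-rawMonoid using (sum)

    linearCombination : ∀ {d} → Vector R d → Vector Carrierᴹ d → Carrierᴹ
    linearCombination c b = sum (λ i → c i *ₗ b i)

    record IsBasis {d} (b : Vector Carrierᴹ d) : Set where
      field
        spanning    : ∀ v → ∃[ c ] v ≈ᴹ linearCombination c b
        independent : ∀ c → linearCombination c b ≈ᴹ 0ᴹ → ∀ i → c i ℝ.≈ 0#

    HasDimension : ℕ → Set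
    HasDimension d = Σ[ b ∈ Vector Carrierᴹ d ] IsBasis b

  record InnerProductSpace : Set₁ where
    field
      vectors : VectorSpace

    open Module vectors

    field
      ⟨_,_⟩      : Carrierᴹ → Carrierᴹ → R
      ⟨⟩-cong    : ∀ {v v′ w w′} → v ≈ᴹ v′ → w ≈ᴹ w′ → ⟨ v , w ⟩ ℝ.≈ ⟨ v′ , w′ ⟩
      ⟨⟩-sym     : ∀ v w → ⟨ v , w ⟩ ℝ.≈ ⟨ w , v ⟩
      ⟨⟩-+       : ∀ v v′ w → ⟨ v +ᴹ v′ , w ⟩ ℝ.≈ ⟨ v , w ⟩ ℝ.+ ⟨ v′ , w ⟩
      ⟨⟩-*       : ∀ c v w → ⟨ c *ₗ v , w ⟩ ℝ.≈ c ℝ.* ⟨ v , w ⟩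
      ⟨⟩-nonNeg  : ∀ v → 0# ℝ.≤ ⟨ v , v ⟩
      ⟨⟩-def     : ∀ v → ⟨ v , v ⟩ ℝ.≈ 0# → v ≈ᴹ 0ᴹ
      -- The norm is the nonnegative square root of ⟨ v , v ⟩.
      ‖_‖        : Carrierᴹ → R
      ‖‖-nonNeg  : ∀ v → 0# ℝ.≤ ‖ v ‖
      ‖‖²≈⟨⟩     : ∀ v → ‖ v ‖ ℝ.* ‖ v ‖ ℝ.≈ ⟨ v , v ⟩

  coordinateSpace : ℕ → VectorSpace
  coordinateSpace d = record
    { Carrierᴹ = Vector R d
    ; _≈ᴹ_ = λ v w → ∀ i → v i ≈ᴹ w i
    ; _+ᴹ_ = λ v w i → v i +ᴹ w i
    ; _*ₗ_ = λ c v i → c *ₗ v i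
    ; _*ᵣ_ = λ v c i → v i *ᵣ c
    ; 0ᴹ   = λ _ → 0ᴹ
    ; -ᴹ_  = λ v i → -ᴹ v i
    ; isModule = record
      { isBimodule = record
        { isBisemimodule = record
          { +ᴹ-isCommutativeMonoid = record
            { isMonoid = record
              { isSemigroup = record
                { isMagma = record
                  { isEquivalence = record
                    { refl  = λ _ → ≈ᴹ-refl
                    ; sym   = λ p i → ≈ᴹ-sym (p i)
                    ; trans = λ p q i → ≈ᴹ-trans (p i) (q i)
                    }
                  ; ∙-cong = λ p q i → +ᴹ-cong (p i) (q i)
                  }
                ; assoc = λ u v w i → +ᴹ-assoc (u i) (v i) (w i)
                }
              ; identity = (λ v i → +ᴹ-identityˡ (v i))
                         , (λ v i → +ᴹ-identityʳ (v i))
              }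
            ; comm = λ v w i → +ᴹ-comm (v i) (w i)
            }
          ; isPreleftSemimodule = record
            { *ₗ-cong      = λ p q i → *ₗ-cong p (q i)
            ; *ₗ-zeroˡ     = λ v i → *ₗ-zeroˡ (v i)
            ; *ₗ-distribʳ  = λ v a b i → *ₗ-distribʳ (v i) a b
            ; *ₗ-identityˡ = λ v i → *ₗ-identityˡ (v i)
            ; *ₗ-assoc     = λ a b v i → *ₗ-assoc a b (v i)
            ; *ₗ-zeroʳ     = λ a i → *ₗ-zeroʳ a
            ; *ₗ-distribˡ  = λ a v w i → *ₗ-distribˡ a (v i) (w i)
            }
          ; isPrerightSemimodule = record
            { *ᵣ-cong      = λ p q i → *ᵣ-cong (p i) q
            ; *ᵣ-zeroʳ     = λ v i → *ᵣ-zeroʳ (v i)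
            ; *ᵣ-distribˡ  = λ v a b i → *ᵣ-distribˡ (v i) a b
            ; *ᵣ-identityʳ = λ v i → *ᵣ-identityʳ (v i)
            ; *ᵣ-assoc     = λ v a b i → *ᵣ-assoc (v i) a b
            ; *ᵣ-zeroˡ     = λ a i → *ᵣ-zeroˡ a
            ; *ᵣ-distribʳ  = λ a v w i → *ᵣ-distribʳ a (v i) (w i)
            }
          ; *ₗ-*ᵣ-assoc = λ a v b i → *ₗ-*ᵣ-assoc a (v i) b
          }
        ; -ᴹ‿cong    = λ p i → -ᴹ‿cong (p i)
        ; -ᴹ‿inverse = (λ v i → -ᴹ‿inverseˡ (v i)) , (λ v i → -ᴹ‿inverseʳ (v i))
        }
      ; *ₗ-*ᵣ-coincident = λ a v i → *ₗ-*ᵣ-coincident a (v i)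
      }
    }
    where
    open Module (TensorUnit.⟨module⟩ {R = ℝ.commutativeRing})

  supNorm : ∀ {d} → Vector R d → R
  supNorm v = Vector.foldr max 0# (λ i → abs (v i))

  data AmbientSpace (d : ℕ) : Set₁ where
    ℓ∞           : AmbientSpace d
    innerProduct : (E : InnerProductSpace) →
                   HasDimension (InnerProductSpace.vectors E) d → AmbientSpace d

  module Space {d : ℕ} where

    vectors : AmbientSpace d → VectorSpace
    vectors ℓ∞                 = coordinateSpace d
    vectors (innerProduct E _) = InnerProductSpace.vectors E

    group : AmbientSpace d → AbelianGroup 0ℓ 0ℓ
    group V = Module.+ᴹ-abelianGroup (vectors V)

    Carrier : AmbientSpace d → Set
    Carrier V = AbelianGroup.Carrier (group V)

    norm : (V : AmbientSpace d) → Carrier V → R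
    norm ℓ∞                 = supNorm
    norm (innerProduct E _) = InnerProductSpace.‖_‖ E

  module _ {d} (V : AmbientSpace d) where
    open Group (AbelianGroup.group (Space.group V)) using (_//_)

    record IsPacking {k} (s : Vector (Space.Carrier V) k) : Set where
      field
        inOpenBall : ∀ i → Space.norm V (s i) < 1#
        separated  : ∀ {i j} → i ≢ j → 1# ℝ.≤ Space.norm V (s i // s j)

    -- P(V) = P.  A separated family has distinct members, so these
    -- families are exactly the enumerated finite packings.
    record IsPackingNumber (P : ℕ) : Set where
      field
        attained : Σ[ s ∈ Vector (Space.Carrier V) P ] IsPacking s
        maximal  : ∀ {k} (s : Vector (Space.Carrier V) k) → IsPacking s → k ℕ.≤ P

  record UltrametricGroup (u ℓ : Level) : Set (lsuc (u ⊔ ℓ)) where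
    field
      abelianGroup : AbelianGroup u ℓ

    open AbelianGroup abelianGroup public

    field
      dist                 : Carrier → Carrier → R
      isUltrametric        : IsGeneralMetric _≈_ ℝ._≈_ ℝ._≤_ 0# max dist
      translationInvariant : TranslationInvariant ℝ._≈_ _∙_ dist

    ∣_∣ : Carrier → R
    ∣ x ∣ = dist x ε

    ∣∣-nonNeg : ∀ x → 0# ℝ.≤ ∣ x ∣
    ∣∣-nonNeg x = IsGeneralMetric.nonNegative isUltrametric

  module Product {d u ℓ} (V : AmbientSpace d) (U : UltrametricGroup u ℓ) where
    private module U = UltrametricGroup U

    group : AbelianGroup u ℓ
    group = DirectProduct.abelianGroup (Space.group V) U.abelianGroup

    open Group (AbelianGroup.group group) using (Carrier; _//_)

    ∣_∣ : Carrier → R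
    ∣ v , x ∣ = max (Space.norm V v) U.∣ x ∣

    ∣∣-nonNeg : ∀ a → 0# ℝ.≤ ∣ a ∣
    ∣∣-nonNeg (v , x) =
      DecTotalOrder.trans ℝ.decTotalOrder
        (U.∣∣-nonNeg x) (ℝ.x≤y⊔x (Space.norm V v) U.∣ x ∣)

    IsOpen : ∀ {p} → Pred Carrier p → Set (u ⊔ p)
    IsOpen S = ∀ {a} → S a → ∃[ ε ] 0# < ε × (∀ {b} → ∣ b // a ∣ < ε → S b)

    IsClosed : ∀ {p} → Pred Carrier p → Set (u ⊔ p)
    IsClosed S = IsOpen (∁ S)

  module Quotient {d u ℓ p} (V : AmbientSpace d) (U : UltrametricGroup u ℓ)
                  {Λ : Pred (AbelianGroup.Carrier (Product.group V U)) p}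
                  (isSubgroup : IsSubgroup (Product.group V U) Λ) where
    private
      module V×U = Group (AbelianGroup.group (Product.group V U))
    open Product V U using (∣_∣; ∣∣-nonNeg)

    X : AbelianGroup u p
    X = Product.group V U / isSubgroup

    module X = AbelianGroup X

    -- The values |a − λ| for λ ∈ Λ.
    Distances : V×U.Carrier → Pred R (u ⊔ p)
    Distances a r = ∃[ l ] Λ l × r ≡ ∣ a V×U.// l ∣

    ‖_‖ : X.Carrier → R
    ‖ a ‖ = ℝ.inf (Distances a)
      (_ , V×U.ε , IsSubgroup.ε-closed isSubgroup , _≡_.refl)
      (0# , λ { (l , _ , _≡_.refl) → ∣∣-nonNeg (a V×U.// l) })

    dist : X.Carrier → X.Carrier → R
    dist x y = ‖ x // y ‖
      where open Group X.group using (_//_)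

    infixr 8 _·_
    _·_ : ℕ → X.Carrier → X.Carrier
    _·_ = RawMonoidDefinitions._×_ X.rawMonoid

    module _ (α : X.Carrier) where

      ρ : ℕ → R
      ρ q = dist (q · α) X.ε

      IsNextReturn : ℕ → ℕ → Set
      IsNextReturn q q′ = Closer q′ × (∀ m → Closer m → q′ ℕ.≤ m)
        where
        Closer : ℕ → Set
        Closer m = q ℕ.< m × ρ m < ρ q

      -- The best-return sequence of α has at least N terms, and they
      -- are q 1, …, q N; the other values of q are irrelevant.
      record AreBestReturns (N : ℕ) (q : ℕ → ℕ) : Set where
        field
          first : q 1 ≡ 1
          next  : ∀ {k} → 1 ℕ.≤ k → k ℕ.< N → IsNextReturn (q k) (q (suc k))

{-# OPTIONS --safe #-}

-- Suppose q_{n+P} < q_n + q_{n+1}.  For 1 ≤ i ≤ P choose a representative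
-- e_i = (v_i , u_i) of q_{n+i} α with |e_i| < r_n.  The differences
-- q_{n+j} − q_{n+i} with 0 ≤ i < j ≤ P are positive and less than q_{n+1},
-- so |e_j − e_i| ≥ r_n, whereas |u_j − u_i| < r_n by the ultrametric
-- inequality; hence ‖v_j − v_i‖ ≥ r_n.  Thus v_0, on the sphere of radius
-- r_n, and v_1, …, v_P, in its interior, are pairwise r_n-separated.  They
-- can be deformed into a packing with P + 1 points: for the sup norm by
-- replacing every coordinate with ±1/2 according to its sign, and for an
-- inner product by normalising, since all angles exceed 60° strictly as
-- soon as at most one of the points lies on the sphere.

module Submission where

open import Defs
open import Algebra.Bundles using (AbelianGroup; CommutativeRing; Group)
import Algebra.Construct.NaturalChoice.Max as Max
open import Algebra.Module.Bundles using (Module)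
import Algebra.Properties.AbelianGroup as AbelianGroupProperties
import Algebra.Properties.Group as GroupProperties
import Algebra.Properties.Monoid.Mult as MonoidMult
import Algebra.Properties.Ring as RingProperties
import Algebra.Solver.Ring.NaturalCoefficients.Default as SemiringSolver
open import Data.Bool.Base using (Bool; true; false)
open import Data.Fin.Base using (Fin; zero; suc; toℕ)
import Data.Fin.Properties as Fin
open import Data.Nat.Base as ℕ using (ℕ; suc; _≥_)
import Data.Nat.Properties as ℕ
open import Data.Product.Base using (∃; ∃-syntax; _×_; _,_; proj₁; proj₂)
open import Data.Sum.Base using (_⊎_; inj₁; inj₂; [_,_]′)
open import Data.Vec.Functional using (Vector)
open import Effect.Monad using (RawMonad)
open import Function.Base using (id)
open import Function.Metric.Structures using (IsGeneralMetric)
open import Relation.Binary.Bundles using (DecTotalOrder)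
import Relation.Binary.Construct.NonStrictToStrict as Strict
open import Relation.Binary.Definitions using (tri<; tri≈; tri>)
import Relation.Binary.Properties.DecTotalOrder as DecTotalOrderProperties
open import Relation.Binary.PropositionalEquality.Core as ≡
  using (_≡_; _≢_; refl; sym; ≢-sym)
import Relation.Binary.Reasoning.PartialOrder as PartialOrderReasoning
open import Relation.Nullary.Decidable.Core using (yes; no; does)
open import Relation.Nullary.Negation using (¬_; contradiction; ¬¬-Monad)
open import Relation.Unary using (Pred)

-- Arithmetic and order in a complete ordered field.

module OrderedField (ℝ : CompleteOrderedField) where

  open CompleteOrderedField ℝ public
  open CommutativeRing commutativeRing public
    using ( +-comm; +-cong; +-congˡ; +-congʳ; +-identityˡ; +-identityʳ
          ; -‿inverseˡ; -‿inverseʳ; -‿cong; *-comm; *-cong; *-congˡ; *-congʳ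
          ; *-identityˡ; zeroˡ; zeroʳ; distribˡ; distribʳ
          ; commutativeSemiring; ring; +-group; +-abelianGroup )
  open DecTotalOrder decTotalOrder public
    using (_≤?_; total; poset; ≤-respˡ-≈; ≤-respʳ-≈; module Eq)
    renaming (refl to ≤-refl; reflexive to ≤-reflexive; trans to ≤-trans; antisym to ≤-antisym)
  open DecTotalOrderProperties decTotalOrder public
    using (<-trans; <-respʳ-≈; <-respˡ-≈; <⇒≱; ≰⇒>; ≮⇒≥)
  open Max (DecTotalOrder.totalOrder decTotalOrder) public
    using (x≤x⊔y; ⊔-sel; ⊔-cong; ⊔-comm)

  open PartialOrderReasoning poset
  open SemiringSolver commutativeSemiring using (solve; _:+_; _:*_; _:=_)

  <⇒≤ : ∀ {x y} → x < y → x ≤ y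
  <⇒≤ = Strict.<⇒≤ _≈_ _≤_

  <-≤-trans : ∀ {x y z} → x < y → y ≤ z → x < z
  <-≤-trans = Strict.<-≤-trans _≈_ _≤_ Eq.sym ≤-trans ≤-antisym ≤-respʳ-≈

  ≤-<-trans : ∀ {x y z} → x ≤ y → y < z → x < z
  ≤-<-trans = Strict.≤-<-trans _≈_ _≤_ ≤-trans ≤-antisym ≤-respˡ-≈

  max-< : ∀ {x y z} → x < z → y < z → max x y < z
  max-< {x} {y} x<z y<z with ⊔-sel x y
  ... | inj₁ max≈x = <-respˡ-≈ (Eq.sym max≈x) x<z
  ... | inj₂ max≈y = <-respˡ-≈ (Eq.sym max≈y) y<z

  ≤-max : ∀ {x y z} → z ≤ max x y → z ≤ x ⊎ z ≤ y
  ≤-max {x} {y} z≤max with ⊔-sel x y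
  ... | inj₁ max≈x = inj₁ (≤-respʳ-≈ max≈x z≤max)
  ... | inj₂ max≈y = inj₂ (≤-respʳ-≈ max≈y z≤max)

  +-monoʳ-≤ : ∀ z {x y} → x ≤ y → z + x ≤ z + y
  +-monoʳ-≤ z {x} {y} x≤y = begin
    z + x  ≈⟨ +-comm z x ⟩
    x + z  ≤⟨ +-monoˡ-≤ z x≤y ⟩
    y + z  ≈⟨ +-comm y z ⟩
    z + y  ∎

  +-monoˡ-< : ∀ z {x y} → x < y → x + z < y + z
  +-monoˡ-< z {x} {y} (x≤y , x≉y) =
    +-monoˡ-≤ z x≤y , λ x+z≈y+z → x≉y (∙-cancelʳ z x y x+z≈y+z)
    where open GroupProperties +-group using (∙-cancelʳ)

  +-monoʳ-< : ∀ z {x y} → x < y → z + x < z + y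
  +-monoʳ-< z {x} {y} x<y = begin-strict
    z + x  ≈⟨ +-comm z x ⟩
    x + z  <⟨ +-monoˡ-< z x<y ⟩
    y + z  ≈⟨ +-comm y z ⟩
    z + y  ∎

  +-mono-<-≤ : ∀ {x y u v} → x < y → u ≤ v → x + u < y + v
  +-mono-<-≤ {y = y} {u} x<y u≤v = <-≤-trans (+-monoˡ-< u x<y) (+-monoʳ-≤ y u≤v)

  +-mono-≤-< : ∀ {x y u v} → x ≤ y → u < v → x + u < y + v
  +-mono-≤-< {y = y} {u} x≤y u<v = ≤-<-trans (+-monoˡ-≤ u x≤y) (+-monoʳ-< y u<v)

  +-cancelʳ-< : ∀ z {x y} → x + z < y + z → x < y
  +-cancelʳ-< z x+z<y+z = ≰⇒> λ y≤x → <⇒≱ x+z<y+z (+-monoˡ-≤ z y≤x)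

  x-y+y≈x : ∀ x y → (x + - y) + y ≈ x
  x-y+y≈x x y = //-rightDividesˡ y x
    where open GroupProperties +-group using (//-rightDividesˡ)

  0≤y-x : ∀ {x y} → x ≤ y → 0# ≤ y + - x
  0≤y-x {x} {y} x≤y = ≤-respˡ-≈ (-‿inverseʳ x) (+-monoˡ-≤ (- x) x≤y)

  -‿anti-< : ∀ {x y} → x < y → - y < - x
  -‿anti-< {x} {y} x<y = +-cancelʳ-< y (begin-strict
    - y + y  ≈⟨ -‿inverseˡ y ⟩
    0#       ≈⟨ -‿inverseˡ x ⟨
    - x + x  <⟨ +-monoʳ-< (- x) x<y ⟩
    - x + y  ∎)

  -‿anti-≤ : ∀ {x y} → x ≤ y → - y ≤ - x
  -‿anti-≤ x≤y = ≮⇒≥ λ -x<-y → <⇒≱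
    (<-respʳ-≈ (⁻¹-involutive _) (<-respˡ-≈ (⁻¹-involutive _) (-‿anti-< -x<-y))) x≤y
    where open GroupProperties +-group using (⁻¹-involutive)

  -0≈0 : - 0# ≈ 0#
  -0≈0 = GroupProperties.ε⁻¹≈ε +-group

  *-monoˡ-≤ : ∀ {z x y} → 0# ≤ z → x ≤ y → z * x ≤ z * y
  *-monoˡ-≤ {z} {x} {y} 0≤z x≤y = begin
    z * x                        ≈⟨ +-identityˡ (z * x) ⟨
    0# + z * x                   ≤⟨ +-monoˡ-≤ (z * x) (*-nonNegative 0≤z (0≤y-x x≤y)) ⟩
    z * (y + - x) + z * x        ≈⟨ distribˡ z (y + - x) x ⟨
    z * ((y + - x) + x)          ≈⟨ *-congˡ (x-y+y≈x y x) ⟩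
    z * y                        ∎

  *-cancelˡ : ∀ {z x y} → ¬ z ≈ 0# → z * x ≈ z * y → x ≈ y
  *-cancelˡ {z} {x} {y} z≉0 zx≈zy with invertible z z≉0
  ... | w , zw≈1 = begin-equality
    x            ≈⟨ expand x ⟨
    w * (z * x)  ≈⟨ *-congˡ zx≈zy ⟩
    w * (z * y)  ≈⟨ expand y ⟩
    y            ∎
    where
    expand : ∀ x → w * (z * x) ≈ x
    expand x = begin-equality
      w * (z * x)  ≈⟨ solve 3 (λ w z x → w :* (z :* x) := (z :* w) :* x) Eq.refl w z x ⟩
      (z * w) * x  ≈⟨ *-congʳ zw≈1 ⟩
      1# * x       ≈⟨ *-identityˡ x ⟩
      x            ∎

  *-monoˡ-< : ∀ {z x y} → 0# < z → x < y → z * x < z * y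
  *-monoˡ-< (0≤z , 0≉z) (x≤y , x≉y) =
    *-monoˡ-≤ 0≤z x≤y , λ zx≈zy → x≉y (*-cancelˡ (λ z≈0 → 0≉z (Eq.sym z≈0)) zx≈zy)

  *-mono-≤ : ∀ {x y u v} → 0# ≤ x → 0# ≤ v → x ≤ y → u ≤ v → x * u ≤ y * v
  *-mono-≤ {x} {y} {u} {v} 0≤x 0≤v x≤y u≤v = begin
    x * u  ≤⟨ *-monoˡ-≤ 0≤x u≤v ⟩
    x * v  ≈⟨ *-comm x v ⟩
    v * x  ≤⟨ *-monoˡ-≤ 0≤v x≤y ⟩
    v * y  ≈⟨ *-comm v y ⟩
    y * v  ∎

  square-mono-≤ : ∀ {x y} → 0# ≤ x → x ≤ y → x * x ≤ y * y
  square-mono-≤ 0≤x x≤y = *-mono-≤ 0≤x (≤-trans 0≤x x≤y) x≤y x≤y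

  square-mono-< : ∀ {x y} → 0# ≤ x → x < y → x * x < y * y
  square-mono-< {x} {y} 0≤x x<y = begin-strict
    x * x  ≤⟨ *-monoˡ-≤ 0≤x (<⇒≤ x<y) ⟩
    x * y  ≈⟨ *-comm x y ⟩
    y * x  <⟨ *-monoˡ-< (≤-<-trans 0≤x x<y) x<y ⟩
    y * y  ∎

  square-cancel-≤ : ∀ {x y} → 0# ≤ y → x * x ≤ y * y → x ≤ y
  square-cancel-≤ 0≤y xx≤yy = ≮⇒≥ λ y<x → <⇒≱ (square-mono-< 0≤y y<x) xx≤yy

  square-cancel-< : ∀ {x y} → 0# ≤ y → x * x < y * y → x < y
  square-cancel-< 0≤y xx<yy = ≰⇒> λ y≤x → <⇒≱ xx<yy (square-mono-≤ 0≤y y≤x)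

  square-injective : ∀ {x y} → 0# ≤ x → 0# ≤ y → x * x ≈ y * y → x ≈ y
  square-injective 0≤x 0≤y xx≈yy =
    ≤-antisym (square-cancel-≤ 0≤y (≤-reflexive xx≈yy))
              (square-cancel-≤ 0≤x (≤-reflexive (Eq.sym xx≈yy)))

  -- If 1 were at most 0, then -1 would be nonnegative, hence so would its square, which is 1;
  -- antisymmetry would then give 1 = 0.
  0<1 : 0# < 1#
  0<1 with total 0# 1#
  ... | inj₁ 0≤1 = 0≤1 , 0≉1
  ... | inj₂ 1≤0 = contradiction (≤-antisym (≤-respʳ-≈ -1*-1≈1 (*-nonNegative 0≤-1 0≤-1)) 1≤0) 0≉1
    where
    open RingProperties ring using (-1*x≈-x; -‿involutive)
    0≤-1 : 0# ≤ - 1#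
    0≤-1 = ≤-respˡ-≈ -0≈0 (-‿anti-≤ 1≤0)
    -1*-1≈1 : - 1# * - 1# ≈ 1#
    -1*-1≈1 = Eq.trans (-1*x≈-x (- 1#)) (-‿involutive 1#)

  +-pos : ∀ {x y} → 0# < x → 0# < y → 0# < x + y
  +-pos 0<x 0<y = <-respˡ-≈ (+-identityˡ 0#) (+-mono-<-≤ 0<x (<⇒≤ 0<y))

  x<x+y : ∀ x {y} → 0# < y → x < x + y
  x<x+y x 0<y = <-respˡ-≈ (+-identityʳ x) (+-monoʳ-< x 0<y)

  *-pos : ∀ {x y} → 0# < x → 0# < y → 0# < x * y
  *-pos {x} 0<x 0<y = <-respˡ-≈ (zeroʳ x) (*-monoˡ-< 0<x 0<y)

  inverse-pos : ∀ {x} → 0# < x → ∃[ y ] 0# < y × x * y ≈ 1#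
  inverse-pos {x} (0≤x , 0≉x) with invertible x (λ x≈0 → 0≉x (Eq.sym x≈0))
  ... | y , xy≈1 = y , ≰⇒> (λ y≤0 → <⇒≱ 0<1 (begin
    1#      ≈⟨ xy≈1 ⟨
    x * y   ≤⟨ *-monoˡ-≤ 0≤x y≤0 ⟩
    x * 0#  ≈⟨ zeroʳ x ⟩
    0#      ∎)) , xy≈1

  -- Bound the square of the larger number by r² and that of the smaller by ab. Strictness in both
  -- cases comes from a: either a² < r², or a² < ab. So b may reach r, which allows one point on the
  -- sphere.
  a²+b²<r²+ab : ∀ {a b r} → 0# < a → 0# ≤ b → a < r → b ≤ r →
                a * a + b * b < r * r + a * b
  a²+b²<r²+ab {a} {b} {r} 0<a 0≤b a<r b≤r with b ≤? a
  ... | yes b≤a = +-mono-<-≤ (square-mono-< (<⇒≤ 0<a) a<r) (begin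
    b * b  ≤⟨ *-monoˡ-≤ 0≤b b≤a ⟩
    b * a  ≈⟨ *-comm b a ⟩
    a * b  ∎)
  ... | no b≰a = begin-strict
    a * a + b * b  <⟨ +-mono-<-≤ (*-monoˡ-< 0<a (≰⇒> b≰a)) (square-mono-≤ 0≤b b≤r) ⟩
    a * b + r * r  ≈⟨ +-comm (a * b) (r * r) ⟩
    r * r + a * b  ∎

  -- A finite minimum of numbers above 1 is still above 1, and downward closure carries each `Q i`
  -- to it. For the empty family any number above 1 would do; `1# + 1#` is at hand.
  uniformly->1 : ∀ {p} {k} (Q : Fin k → Pred Carrier p) →
                 (∀ i {x y} → x ≤ y → Q i y → Q i x) →
                 (∀ i → ∃[ x ] 1# < x × Q i x) → ∃[ x ] 1# < x × (∀ i → Q i x)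
  uniformly->1 {k = ℕ.zero}  Q down each = 1# + 1# , x<x+y 1# 0<1 , λ ()
  uniformly->1 {k = suc k} Q down each
    with each zero | uniformly->1 (λ i → Q (suc i)) (λ i → down (suc i)) (λ i → each (suc i))
  ... | x , 1<x , Qx | y , 1<y , Qy with total x y
  ... | inj₁ x≤y = x , 1<x , λ { zero → Qx ; (suc i) → down (suc i) x≤y (Qy i) }
  ... | inj₂ y≤x = y , 1<y , λ { zero → down zero y≤x Qx ; (suc i) → Qy i }

  neg-minus : ∀ x y → - (x + - y) ≈ y + - x
  neg-minus = AbelianGroupProperties.⁻¹-anti-homo‿- +-abelianGroup

  ∣x-y∣≈∣y-x∣ : ∀ x y → ∣ x + - y ∣ ≈ ∣ y + - x ∣
  ∣x-y∣≈∣y-x∣ x y = Eq.trans (⊔-comm (x + - y) (- (x + - y)))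
    (⊔-cong (neg-minus x y) (Eq.sym (neg-minus y x)))

-- Packings in inner-product spaces.

module InnerProduct (ℝ : CompleteOrderedField) (E : Geometry.InnerProductSpace ℝ) where

  open OrderedField ℝ
  open Geometry.InnerProductSpace E
  open Module vectors
  open Group (AbelianGroup.group +ᴹ-abelianGroup) using (_//_)
  open GroupProperties (AbelianGroup.group +ᴹ-abelianGroup) using (//-rightDividesˡ; //-rightDividesʳ)
  open PartialOrderReasoning poset
  open SemiringSolver commutativeSemiring using (solve; _:+_; _:*_; _:=_)

  -- The norm is given as a bare function, but being nonnegative it is determined by its square, and
  -- the inner product respects equality.
  ‖‖-cong : ∀ {v w} → v ≈ᴹ w → ‖ v ‖ ≈ ‖ w ‖
  ‖‖-cong {v} {w} v≈w = square-injective (‖‖-nonNeg v) (‖‖-nonNeg w) (begin-equality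
    ‖ v ‖ * ‖ v ‖  ≈⟨ ‖‖²≈⟨⟩ v ⟩
    ⟨ v , v ⟩      ≈⟨ ⟨⟩-cong v≈w v≈w ⟩
    ⟨ w , w ⟩      ≈⟨ ‖‖²≈⟨⟩ w ⟨
    ‖ w ‖ * ‖ w ‖  ∎)

  ⟨⟩-*ʳ : ∀ c v w → ⟨ v , c *ₗ w ⟩ ≈ c * ⟨ v , w ⟩
  ⟨⟩-*ʳ c v w = begin-equality
    ⟨ v , c *ₗ w ⟩  ≈⟨ ⟨⟩-sym v (c *ₗ w) ⟩
    ⟨ c *ₗ w , v ⟩  ≈⟨ ⟨⟩-* c w v ⟩
    c * ⟨ w , v ⟩   ≈⟨ *-congˡ (⟨⟩-sym w v) ⟩
    c * ⟨ v , w ⟩   ∎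

  ⟨⟩-** : ∀ b c v w → ⟨ b *ₗ v , c *ₗ w ⟩ ≈ b * (c * ⟨ v , w ⟩)
  ⟨⟩-** b c v w = Eq.trans (⟨⟩-* b v (c *ₗ w)) (*-congˡ (⟨⟩-*ʳ c v w))

  ⟨⟩-+ʳ : ∀ v w w′ → ⟨ v , w +ᴹ w′ ⟩ ≈ ⟨ v , w ⟩ + ⟨ v , w′ ⟩
  ⟨⟩-+ʳ v w w′ = begin-equality
    ⟨ v , w +ᴹ w′ ⟩          ≈⟨ ⟨⟩-sym v (w +ᴹ w′) ⟩
    ⟨ w +ᴹ w′ , v ⟩          ≈⟨ ⟨⟩-+ w w′ v ⟩
    ⟨ w , v ⟩ + ⟨ w′ , v ⟩   ≈⟨ +-cong (⟨⟩-sym w v) (⟨⟩-sym w′ v) ⟩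
    ⟨ v , w ⟩ + ⟨ v , w′ ⟩   ∎

  ‖‖²-+ : ∀ v w → ⟨ v +ᴹ w , v +ᴹ w ⟩ ≈ ⟨ v , v ⟩ + (⟨ v , w ⟩ + ⟨ v , w ⟩) + ⟨ w , w ⟩
  ‖‖²-+ v w = begin-equality
    ⟨ v +ᴹ w , v +ᴹ w ⟩
      ≈⟨ ⟨⟩-+ v w (v +ᴹ w) ⟩
    ⟨ v , v +ᴹ w ⟩ + ⟨ w , v +ᴹ w ⟩
      ≈⟨ +-cong (⟨⟩-+ʳ v v w) (Eq.trans (⟨⟩-+ʳ w v w) (+-congʳ (⟨⟩-sym w v))) ⟩
    (⟨ v , v ⟩ + ⟨ v , w ⟩) + (⟨ v , w ⟩ + ⟨ w , w ⟩)
      ≈⟨ solve 3 (λ a b c → (a :+ b) :+ (b :+ c) := a :+ (b :+ b) :+ c) Eq.refl _ _ _ ⟩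
    ⟨ v , v ⟩ + (⟨ v , w ⟩ + ⟨ v , w ⟩) + ⟨ w , w ⟩ ∎

  -- The law of cosines, with the cross terms on the left so that only sums occur and the semiring
  -- solver applies. It follows by expanding v as (v - w) + w.
  ‖‖²-// : ∀ v w → ⟨ v // w , v // w ⟩ + (⟨ v , w ⟩ + ⟨ v , w ⟩) ≈ ⟨ v , v ⟩ + ⟨ w , w ⟩
  ‖‖²-// v w = begin-equality
    ⟨ z , z ⟩ + (⟨ v , w ⟩ + ⟨ v , w ⟩)
      ≈⟨ +-congˡ (+-cong vw vw) ⟩
    ⟨ z , z ⟩ + ((⟨ z , w ⟩ + ⟨ w , w ⟩) + (⟨ z , w ⟩ + ⟨ w , w ⟩))
      ≈⟨ solve 3 (λ a b c → a :+ ((b :+ c) :+ (b :+ c)) := (a :+ (b :+ b) :+ c) :+ c)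
               Eq.refl _ _ _ ⟩
    (⟨ z , z ⟩ + (⟨ z , w ⟩ + ⟨ z , w ⟩) + ⟨ w , w ⟩) + ⟨ w , w ⟩
      ≈⟨ +-congʳ (‖‖²-+ z w) ⟨
    ⟨ z +ᴹ w , z +ᴹ w ⟩ + ⟨ w , w ⟩
      ≈⟨ +-congʳ (⟨⟩-cong z+w≈v z+w≈v) ⟩
    ⟨ v , v ⟩ + ⟨ w , w ⟩ ∎
    where
    z = v // w
    z+w≈v : z +ᴹ w ≈ᴹ v
    z+w≈v = //-rightDividesˡ w v
    vw : ⟨ v , w ⟩ ≈ ⟨ z , w ⟩ + ⟨ w , w ⟩
    vw = Eq.trans (⟨⟩-cong (≈ᴹ-sym z+w≈v) ≈ᴹ-refl) (⟨⟩-+ z w w)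

  ‖v//w‖≈‖w//v‖ : ∀ v w → ‖ v // w ‖ ≈ ‖ w // v ‖
  ‖v//w‖≈‖w//v‖ v w = square-injective (‖‖-nonNeg _) (‖‖-nonNeg _) (begin-equality
    ‖ v // w ‖ * ‖ v // w ‖  ≈⟨ ‖‖²≈⟨⟩ _ ⟩
    ⟨ v // w , v // w ⟩      ≈⟨ ∙-cancelʳ _ _ _ eq ⟩
    ⟨ w // v , w // v ⟩      ≈⟨ ‖‖²≈⟨⟩ _ ⟨
    ‖ w // v ‖ * ‖ w // v ‖  ∎)
    where
    open GroupProperties +-group using (∙-cancelʳ)
    eq : ⟨ v // w , v // w ⟩ + (⟨ v , w ⟩ + ⟨ v , w ⟩) ≈
         ⟨ w // v , w // v ⟩ + (⟨ v , w ⟩ + ⟨ v , w ⟩)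
    eq = begin-equality
      ⟨ v // w , v // w ⟩ + (⟨ v , w ⟩ + ⟨ v , w ⟩)  ≈⟨ ‖‖²-// v w ⟩
      ⟨ v , v ⟩ + ⟨ w , w ⟩                          ≈⟨ +-comm _ _ ⟩
      ⟨ w , w ⟩ + ⟨ v , v ⟩                          ≈⟨ ‖‖²-// w v ⟨
      ⟨ w // v , w // v ⟩ + (⟨ w , v ⟩ + ⟨ w , v ⟩)
        ≈⟨ +-congˡ (+-cong (⟨⟩-sym w v) (⟨⟩-sym w v)) ⟩
      ⟨ w // v , w // v ⟩ + (⟨ v , w ⟩ + ⟨ v , w ⟩)  ∎

  ‖‖-* : ∀ {c} v → 0# ≤ c → ‖ c *ₗ v ‖ ≈ c * ‖ v ‖
  ‖‖-* {c} v 0≤c = square-injective (‖‖-nonNeg _) (*-nonNegative 0≤c (‖‖-nonNeg v)) (begin-equality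
    ‖ c *ₗ v ‖ * ‖ c *ₗ v ‖    ≈⟨ ‖‖²≈⟨⟩ (c *ₗ v) ⟩
    ⟨ c *ₗ v , c *ₗ v ⟩        ≈⟨ ⟨⟩-** c c v v ⟩
    c * (c * ⟨ v , v ⟩)        ≈⟨ *-congˡ (*-congˡ (‖‖²≈⟨⟩ v)) ⟨
    c * (c * (‖ v ‖ * ‖ v ‖))
      ≈⟨ solve 2 (λ c a → c :* (c :* (a :* a)) := (c :* a) :* (c :* a)) Eq.refl c ‖ v ‖ ⟩
    (c * ‖ v ‖) * (c * ‖ v ‖)  ∎)

  *ₗ-distrib-// : ∀ c v w → c *ₗ (v // w) ≈ᴹ (c *ₗ v) // (c *ₗ w)
  *ₗ-distrib-// c v w = ≈ᴹ-trans (≈ᴹ-sym (//-rightDividesʳ (c *ₗ w) (c *ₗ (v // w))))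
    (+ᴹ-congʳ (≈ᴹ-trans (≈ᴹ-sym (*ₗ-distribˡ c (v // w) w)) (*ₗ-congˡ (//-rightDividesˡ w v))))

  ‖v+v‖≈‖v‖+‖v‖ : ∀ v → ‖ v +ᴹ v ‖ ≈ ‖ v ‖ + ‖ v ‖
  ‖v+v‖≈‖v‖+‖v‖ v = begin-equality
    ‖ v +ᴹ v ‖             ≈⟨ ‖‖-cong (+ᴹ-cong (*ₗ-identityˡ v) (*ₗ-identityˡ v)) ⟨
    ‖ 1# *ₗ v +ᴹ 1# *ₗ v ‖ ≈⟨ ‖‖-cong (*ₗ-distribʳ v 1# 1#) ⟨
    ‖ (1# + 1#) *ₗ v ‖     ≈⟨ ‖‖-* v (<⇒≤ (+-pos 0<1 0<1)) ⟩
    (1# + 1#) * ‖ v ‖      ≈⟨ distribʳ ‖ v ‖ 1# 1# ⟩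
    1# * ‖ v ‖ + 1# * ‖ v ‖ ≈⟨ +-cong (*-identityˡ ‖ v ‖) (*-identityˡ ‖ v ‖) ⟩
    ‖ v ‖ + ‖ v ‖          ∎

  ‖-v‖≈‖v‖ : ∀ v → ‖ -ᴹ v ‖ ≈ ‖ v ‖
  ‖-v‖≈‖v‖ v = begin-equality
    ‖ -ᴹ v ‖     ≈⟨ ‖‖-cong (+ᴹ-identityˡ (-ᴹ v)) ⟨
    ‖ 0ᴹ // v ‖  ≈⟨ ‖v//w‖≈‖w//v‖ 0ᴹ v ⟩
    ‖ v // 0ᴹ ‖  ≈⟨ ‖‖-cong v//0≈v ⟩
    ‖ v ‖        ∎
    where
    v//0≈v : v // 0ᴹ ≈ᴹ v
    v//0≈v = ≈ᴹ-trans (+ᴹ-congʳ (≈ᴹ-sym (+ᴹ-identityʳ v))) (//-rightDividesʳ 0ᴹ v)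

  -- In other words, the angle between v and w exceeds 60°.
  1<‖unit//unit‖ : ∀ {r b c} v w → 0# < ‖ v ‖ → ‖ v ‖ < r → ‖ w ‖ ≤ r → r ≤ ‖ v // w ‖ →
                   0# < b → 0# < c → ‖ v ‖ * b ≈ 1# → ‖ w ‖ * c ≈ 1# →
                   1# < ‖ (b *ₗ v) // (c *ₗ w) ‖
  1<‖unit//unit‖ {r} {b} {c} v w 0<‖v‖ ‖v‖<r ‖w‖≤r r≤‖v//w‖ 0<b 0<c ‖v‖b≈1 ‖w‖c≈1 =
    square-cancel-< (‖‖-nonNeg _) (begin-strict
      1# * 1#      ≈⟨ *-identityˡ 1# ⟩
      1#           <⟨ 1<D ⟩
      ⟨ bv // cw , bv // cw ⟩  ≈⟨ ‖‖²≈⟨⟩ _ ⟨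
      ‖ bv // cw ‖ * ‖ bv // cw ‖  ∎)
    where
    bv = b *ₗ v
    cw = c *ₗ w
    2⟨v,w⟩ = ⟨ v , w ⟩ + ⟨ v , w ⟩

    -- The law of cosines with r² as a lower bound for the squared distance; the upper bound for the
    -- squared lengths is `a²+b²<r²+ab`. Dividing by the two lengths turns this into a cosine below
    -- 1/2.
    2⟨v,w⟩<‖v‖‖w‖ : 2⟨v,w⟩ < ‖ v ‖ * ‖ w ‖
    2⟨v,w⟩<‖v‖‖w‖ = +-cancelʳ-< (r * r) (begin-strict
      2⟨v,w⟩ + r * r                       ≈⟨ +-comm _ _ ⟩
      r * r + 2⟨v,w⟩
        ≤⟨ +-monoˡ-≤ _ (square-mono-≤ (<⇒≤ (<-trans 0<‖v‖ ‖v‖<r)) r≤‖v//w‖) ⟩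
      ‖ v // w ‖ * ‖ v // w ‖ + 2⟨v,w⟩     ≈⟨ +-congʳ (‖‖²≈⟨⟩ (v // w)) ⟩
      ⟨ v // w , v // w ⟩ + 2⟨v,w⟩         ≈⟨ ‖‖²-// v w ⟩
      ⟨ v , v ⟩ + ⟨ w , w ⟩                ≈⟨ +-cong (‖‖²≈⟨⟩ v) (‖‖²≈⟨⟩ w) ⟨
      ‖ v ‖ * ‖ v ‖ + ‖ w ‖ * ‖ w ‖        <⟨ a²+b²<r²+ab 0<‖v‖ (‖‖-nonNeg w) ‖v‖<r ‖w‖≤r ⟩
      r * r + ‖ v ‖ * ‖ w ‖                ≈⟨ +-comm _ _ ⟩
      ‖ v ‖ * ‖ w ‖ + r * r                ∎)

    ⟨unit,unit⟩ : ∀ {a} x → ‖ x ‖ * a ≈ 1# → ⟨ a *ₗ x , a *ₗ x ⟩ ≈ 1#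
    ⟨unit,unit⟩ {a} x ‖x‖a≈1 = begin-equality
      ⟨ a *ₗ x , a *ₗ x ⟩        ≈⟨ ⟨⟩-** a a x x ⟩
      a * (a * ⟨ x , x ⟩)        ≈⟨ *-congˡ (*-congˡ (‖‖²≈⟨⟩ x)) ⟨
      a * (a * (‖ x ‖ * ‖ x ‖))
        ≈⟨ solve 2 (λ a n → a :* (a :* (n :* n)) := (n :* a) :* (n :* a)) Eq.refl a ‖ x ‖ ⟩
      (‖ x ‖ * a) * (‖ x ‖ * a)  ≈⟨ *-cong ‖x‖a≈1 ‖x‖a≈1 ⟩
      1# * 1#                    ≈⟨ *-identityˡ 1# ⟩
      1#                         ∎

    2⟨bv,cw⟩<1 : ⟨ bv , cw ⟩ + ⟨ bv , cw ⟩ < 1#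
    2⟨bv,cw⟩<1 = begin-strict
      ⟨ bv , cw ⟩ + ⟨ bv , cw ⟩  ≈⟨ +-cong (⟨⟩-** b c v w) (⟨⟩-** b c v w) ⟩
      b * (c * ⟨ v , w ⟩) + b * (c * ⟨ v , w ⟩)
        ≈⟨ solve 3 (λ b c g → b :* (c :* g) :+ b :* (c :* g) := (b :* c) :* (g :+ g))
                 Eq.refl b c ⟨ v , w ⟩ ⟩
      (b * c) * 2⟨v,w⟩           <⟨ *-monoˡ-< (*-pos 0<b 0<c) 2⟨v,w⟩<‖v‖‖w‖ ⟩
      (b * c) * (‖ v ‖ * ‖ w ‖)
        ≈⟨ solve 4 (λ b c m n → (b :* c) :* (m :* n) := (m :* b) :* (n :* c))
                 Eq.refl b c ‖ v ‖ ‖ w ‖ ⟩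
      (‖ v ‖ * b) * (‖ w ‖ * c)  ≈⟨ *-cong ‖v‖b≈1 ‖w‖c≈1 ⟩
      1# * 1#                    ≈⟨ *-identityˡ 1# ⟩
      1#                         ∎

    1<D : 1# < ⟨ bv // cw , bv // cw ⟩
    1<D = +-cancelʳ-< 1# (begin-strict
      1# + 1#                        ≈⟨ +-cong (⟨unit,unit⟩ v ‖v‖b≈1) (⟨unit,unit⟩ w ‖w‖c≈1) ⟨
      ⟨ bv , bv ⟩ + ⟨ cw , cw ⟩      ≈⟨ ‖‖²-// bv cw ⟨
      ⟨ bv // cw , bv // cw ⟩ + (⟨ bv , cw ⟩ + ⟨ bv , cw ⟩)  <⟨ +-monoʳ-< _ 2⟨bv,cw⟩<1 ⟩
      ⟨ bv // cw , bv // cw ⟩ + 1#   ∎)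

  module _ {d} (dim : Geometry.HasDimension ℝ vectors d) where

    open Geometry ℝ using (AmbientSpace; innerProduct; IsPacking; IsPackingNumber)

    private
      V : AmbientSpace d
      V = innerProduct E dim

    -- Multiplication by 1/R carries the ball of radius R and the separation R to the unit ball and
    -- separation 1.
    packing-fromScale : ∀ {k R} (s : Vector Carrierᴹ k) → 0# < R → (∀ i → ‖ s i ‖ < R) →
                        (∀ {i j} → i ≢ j → R ≤ ‖ s i // s j ‖) → ∃ (IsPacking V {k})
    packing-fromScale {R = R} s 0<R inBall separated with inverse-pos 0<R
    ... | t , 0<t , Rt≈1 = (λ i → t *ₗ s i) , record
      { inOpenBall = λ i → begin-strict
          ‖ t *ₗ s i ‖  ≈⟨ ‖‖-* (s i) (<⇒≤ 0<t) ⟩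
          t * ‖ s i ‖   <⟨ *-monoˡ-< 0<t (inBall i) ⟩
          t * R         ≈⟨ tR≈1 ⟩
          1#            ∎
      ; separated = λ {i} {j} i≢j → begin
          1#                         ≈⟨ tR≈1 ⟨
          t * R                      ≤⟨ *-monoˡ-≤ (<⇒≤ 0<t) (separated i≢j) ⟩
          t * ‖ s i // s j ‖         ≈⟨ ‖‖-* _ (<⇒≤ 0<t) ⟨
          ‖ t *ₗ (s i // s j) ‖      ≈⟨ ‖‖-cong (*ₗ-distrib-// t (s i) (s j)) ⟩
          ‖ t *ₗ s i // t *ₗ s j ‖   ∎
      }
      where
      tR≈1 : t * R ≈ 1#
      tR≈1 = Eq.trans (*-comm t R) Rt≈1

    -- The points v and -v form a packing after scaling. This disposes of P ≤ 1, where the interior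
    -- points are too few for the argument that they are nonzero.
    packingNumber-≥2 : ∀ {P} → IsPackingNumber V P → ∀ v → 0# < ‖ v ‖ → 2 ℕ.≤ P
    packingNumber-≥2 isP v 0<‖v‖ = maximal (proj₁ packing) (proj₂ packing)
      where
      open IsPackingNumber isP using (maximal)

      ±v : Vector Carrierᴹ 2
      ±v zero       = v
      ±v (suc zero) = -ᴹ v

      ‖±v‖≈‖v‖ : ∀ i → ‖ ±v i ‖ ≈ ‖ v ‖
      ‖±v‖≈‖v‖ zero       = Eq.refl
      ‖±v‖≈‖v‖ (suc zero) = ‖-v‖≈‖v‖ v

      ‖v//-v‖≈ : ‖ v // (-ᴹ v) ‖ ≈ ‖ v ‖ + ‖ v ‖
      ‖v//-v‖≈ = Eq.trans (‖‖-cong (+ᴹ-congˡ (⁻¹-involutive v))) (‖v+v‖≈‖v‖+‖v‖ v)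
        where open GroupProperties (AbelianGroup.group +ᴹ-abelianGroup) using (⁻¹-involutive)

      separated : ∀ {i j} → i ≢ j → ‖ v ‖ + ‖ v ‖ ≤ ‖ ±v i // ±v j ‖
      separated {zero}     {zero}     i≢j = contradiction refl i≢j
      separated {zero}     {suc zero} _   = ≤-reflexive (Eq.sym ‖v//-v‖≈)
      separated {suc zero} {zero}     _   =
        ≤-reflexive (Eq.trans (Eq.sym ‖v//-v‖≈) (‖v//w‖≈‖w//v‖ v (-ᴹ v)))
      separated {suc zero} {suc zero} i≢j = contradiction refl i≢j

      packing : ∃ (IsPacking V {2})
      -- The radius 2‖v‖ is exactly the distance from v to -v, and it exceeds ‖v‖ because v has
      -- positive norm.
      packing = packing-fromScale ±v (+-pos 0<‖v‖ 0<‖v‖)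
        (λ i → ≤-<-trans (≤-reflexive (‖±v‖≈‖v‖ i)) (x<x+y ‖ v ‖ 0<‖v‖)) separated

    module _ {k r} (v : Vector Carrierᴹ (suc (suc (suc k)))) (0<r : 0# < r)
             (‖v₀‖≈r : ‖ v zero ‖ ≈ r) (‖vᵢ‖<r : ∀ i → ‖ v (suc i) ‖ < r)
             (r≤‖vᵢ//vⱼ‖ : ∀ {i j} → i ≢ j → r ≤ ‖ v i // v j ‖) where

      -- A second point of the open ball is at distance ≥ r from v (suc i),
      -- hence the latter is not the origin.
      0<‖vᵢ‖ : ∀ i → 0# < ‖ v i ‖
      0<‖vᵢ‖ zero    = <-respʳ-≈ (Eq.sym ‖v₀‖≈r) 0<r
      0<‖vᵢ‖ (suc i) = ‖‖-nonNeg _ , λ 0≈‖vᵢ‖ → <⇒≱ (‖vᵢ‖<r (other i)) (begin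
        r                                  ≤⟨ r≤‖vᵢ//vⱼ‖ (λ eq → other≢ i (Fin.suc-injective eq)) ⟩
        ‖ v (suc i) // v (suc (other i)) ‖ ≈⟨ ‖‖-cong (+ᴹ-congʳ (vᵢ≈0 0≈‖vᵢ‖)) ⟩
        ‖ 0ᴹ // v (suc (other i)) ‖        ≈⟨ ‖‖-cong (+ᴹ-identityˡ _) ⟩
        ‖ -ᴹ v (suc (other i)) ‖           ≈⟨ ‖-v‖≈‖v‖ _ ⟩
        ‖ v (suc (other i)) ‖              ∎)
        where
        other : Fin (suc (suc k)) → Fin (suc (suc k))
        other zero    = suc zero
        other (suc _) = zero

        other≢ : ∀ i → i ≢ other i
        other≢ zero    ()
        other≢ (suc _) ()

        vᵢ≈0 : 0# ≈ ‖ v (suc i) ‖ → v (suc i) ≈ᴹ 0ᴹ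
        vᵢ≈0 0≈‖vᵢ‖ = ⟨⟩-def _ (begin-equality
          ⟨ v (suc i) , v (suc i) ⟩      ≈⟨ ‖‖²≈⟨⟩ _ ⟨
          ‖ v (suc i) ‖ * ‖ v (suc i) ‖  ≈⟨ *-congʳ 0≈‖vᵢ‖ ⟨
          0# * ‖ v (suc i) ‖             ≈⟨ zeroˡ _ ⟩
          0#                             ∎)

      ‖vᵢ‖≤r : ∀ i → ‖ v i ‖ ≤ r
      ‖vᵢ‖≤r zero    = ≤-reflexive ‖v₀‖≈r
      ‖vᵢ‖≤r (suc i) = <⇒≤ (‖vᵢ‖<r i)

      -- The `c i` are the reciprocals of the norms; as parameters they are fixed once for all the
      -- comparisons below.
      module Normalised (c : Fin (suc (suc (suc k))) → Carrier) (0<c : ∀ i → 0# < c i)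
                        (‖vᵢ‖c≈1 : ∀ i → ‖ v i ‖ * c i ≈ 1#) where

        unit : Vector Carrierᴹ (suc (suc (suc k)))
        unit i = c i *ₗ v i

        ‖unit‖≈1 : ∀ i → ‖ unit i ‖ ≈ 1#
        ‖unit‖≈1 i = Eq.trans (‖‖-* (v i) (<⇒≤ (0<c i))) (Eq.trans (*-comm (c i) ‖ v i ‖) (‖vᵢ‖c≈1 i))

        -- Of two distinct indices one is a successor, so its point is in the open ball and can take
        -- the strict role in `1<‖unit//unit‖`; symmetry of the distance covers the order in which
        -- it comes second.
        unit-separated : ∀ i j → i ≢ j → 1# < ‖ unit i // unit j ‖
        unit-separated zero zero i≢j = contradiction refl i≢j
        unit-separated (suc i) j i≢j =
          1<‖unit//unit‖ (v (suc i)) (v j) (0<‖vᵢ‖ (suc i)) (‖vᵢ‖<r i) (‖vᵢ‖≤r j) (r≤‖vᵢ//vⱼ‖ i≢j)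
            (0<c (suc i)) (0<c j) (‖vᵢ‖c≈1 (suc i)) (‖vᵢ‖c≈1 j)
        unit-separated zero (suc j) i≢j =
          <-respʳ-≈ (‖v//w‖≈‖w//v‖ _ _) (unit-separated (suc j) zero (≢-sym i≢j))

        -- The unit vectors lie on the unit sphere, not in the open ball. A common separation m > 1
        -- leaves room to shrink them by 1/m, which puts them inside and keeps distances at least 1.
        pairwiseBound : ∃[ m ] 1# < m × (∀ i j → i ≢ j → m ≤ ‖ unit i // unit j ‖)
        -- The minimum is taken over j for each fixed i, then over i.
        pairwiseBound = uniformly->1 _ (λ i x≤y y≤ j i≢j → ≤-trans x≤y (y≤ j i≢j))
          (λ i → uniformly->1 _ (λ j x≤y y≤ i≢j → ≤-trans x≤y (y≤ i≢j)) (bound i))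
          where
          bound : ∀ i j → ∃[ m ] 1# < m × (i ≢ j → m ≤ ‖ unit i // unit j ‖)
          bound i j with i Fin.≟ j
          -- On the diagonal nothing is required, so any value above 1 serves.
          ... | yes i≡j = 1# + 1# , x<x+y 1# 0<1 , λ i≢j → contradiction i≡j i≢j
          ... | no  i≢j = ‖ unit i // unit j ‖ , unit-separated i j i≢j , λ _ → ≤-refl

        packing : ∃ (IsPacking V {suc (suc (suc k))})
        packing = packing-fromScale unit (<-trans 0<1 1<m)
          (λ i → ≤-<-trans (≤-reflexive (‖unit‖≈1 i)) 1<m) (λ {i} {j} → m≤ i j)
          where
          1<m = proj₁ (proj₂ pairwiseBound)
          m≤  = proj₂ (proj₂ pairwiseBound)

      normalisedPacking : ∃ (IsPacking V {suc (suc (suc k))})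
      normalisedPacking = Normalised.packing (λ i → proj₁ (inverses i))
        (λ i → proj₁ (proj₂ (inverses i))) (λ i → proj₂ (proj₂ (inverses i)))
        where
        inverses : ∀ i → ∃[ c ] 0# < c × ‖ v i ‖ * c ≈ 1#
        inverses i = inverse-pos (0<‖vᵢ‖ i)

    packingNumber-maximal-closed : ∀ {P r} → IsPackingNumber V P → (v : Vector Carrierᴹ (suc P)) →
      0# < r → ‖ v zero ‖ ≈ r → (∀ i → ‖ v (suc i) ‖ < r) →
      ¬ (∀ {i j} → i ≢ j → r ≤ ‖ v i // v j ‖)
    -- For P = 0 and P = 1 the nonzero vector `v zero` already contradicts maximality through the
    -- pair of itself and its negative.
    packingNumber-maximal-closed {0} isP v 0<r ‖v₀‖≈r _ _ =
      contradiction (packingNumber-≥2 isP (v zero) (<-respʳ-≈ (Eq.sym ‖v₀‖≈r) 0<r)) λ ()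
    packingNumber-maximal-closed {1} isP v 0<r ‖v₀‖≈r _ _ =
      contradiction (packingNumber-≥2 isP (v zero) (<-respʳ-≈ (Eq.sym ‖v₀‖≈r) 0<r)) λ { (ℕ.s≤s ()) }
    packingNumber-maximal-closed {suc (suc _)} isP v 0<r ‖v₀‖≈r ‖vᵢ‖<r separated =
      ℕ.1+n≰n (IsPackingNumber.maximal isP (proj₁ packing) (proj₂ packing))
      where
      packing : ∃ (IsPacking V)
      packing = normalisedPacking v 0<r ‖v₀‖≈r ‖vᵢ‖<r separated

-- Packings for the sup norm.

module SupNorm (ℝ : CompleteOrderedField) where

  open OrderedField ℝ
  open Geometry ℝ using (supNorm; ℓ∞; IsPacking; IsPackingNumber)
  open PartialOrderReasoning poset

  ∣x∣≤supNorm : ∀ {d} (v : Vector Carrier d) i → ∣ v i ∣ ≤ supNorm v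
  ∣x∣≤supNorm v zero    = x≤x⊔y _ _
  ∣x∣≤supNorm v (suc i) = ≤-trans (∣x∣≤supNorm (λ i → v (suc i)) i) (x≤y⊔x _ _)

  supNorm-< : ∀ {d c} (v : Vector Carrier d) → 0# < c → (∀ i → ∣ v i ∣ < c) → supNorm v < c
  supNorm-< {ℕ.zero} v 0<c ∣v∣<c = 0<c
  supNorm-< {suc d}  v 0<c ∣v∣<c =
    max-< (∣v∣<c zero) (supNorm-< (λ i → v (suc i)) 0<c (λ i → ∣v∣<c (suc i)))

  -- A finite maximum is attained; positivity of c excludes the starting value 0 of the fold.
  ≤-supNorm : ∀ {d c} (v : Vector Carrier d) → 0# < c → c ≤ supNorm v → ∃[ i ] c ≤ ∣ v i ∣
  ≤-supNorm {ℕ.zero} v 0<c c≤0 = contradiction c≤0 (<⇒≱ 0<c)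
  ≤-supNorm {suc d}  v 0<c c≤sup with ≤-max c≤sup
  ... | inj₁ c≤∣v₀∣ = zero , c≤∣v₀∣
  ... | inj₂ c≤rest with ≤-supNorm (λ i → v (suc i)) 0<c c≤rest
  ...   | i , c≤∣vᵢ∣ = suc i , c≤∣vᵢ∣

  supNorm-cong : ∀ {d} {v w : Vector Carrier d} → (∀ i → v i ≈ w i) → supNorm v ≈ supNorm w
  supNorm-cong {ℕ.zero} v≈w = Eq.refl
  supNorm-cong {suc d}  v≈w =
    ⊔-cong (⊔-cong (v≈w zero) (-‿cong (v≈w zero))) (supNorm-cong (λ i → v≈w (suc i)))

  supNorm-sym : ∀ {d} (v w : Vector Carrier d) →
                supNorm (λ i → v i + - w i) ≈ supNorm (λ i → w i + - v i)
  supNorm-sym {ℕ.zero} v w = Eq.refl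
  supNorm-sym {suc d}  v w =
    ⊔-cong (∣x-y∣≈∣y-x∣ (v zero) (w zero)) (supNorm-sym (λ i → v (suc i)) (λ i → w (suc i)))

  -- The members of the family x lie in ]−r, r] or in [−r, r[, and 0 is given
  -- the sign of the open end, so that two members of the same sign are at
  -- distance less than r.
  record Signs (r : Carrier) {I : Set} (x : I → Carrier) : Set where
    field
      sign : I → Bool
      near : ∀ i j → sign i ≡ sign j → x i + - x j < r

    near-abs : ∀ i j → sign i ≡ sign j → ∣ x i + - x j ∣ < r
    near-abs i j eq = max-< (near i j eq)
      (<-respˡ-≈ (Eq.sym (neg-minus (x i) (x j))) (near j i (sym eq)))

  -- Here -r is the excluded end, so 0 joins the negative members. For two members ≤ 0 the
  -- strictness comes from -xⱼ < r, for two positive ones from -xⱼ < 0.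
  signs-leftOpen : ∀ {r} {I : Set} {x : I → Carrier} →
                   (∀ i → - x i < r) → (∀ i → x i ≤ r) → Signs r x
  signs-leftOpen {r} {I} {x} -x<r x≤r = record { sign = λ i → does (x i ≤? 0#) ; near = near }
    where
    near : ∀ i j → does (x i ≤? 0#) ≡ does (x j ≤? 0#) → x i + - x j < r
    near i j eq with x i ≤? 0# | x j ≤? 0#
    near i j () | yes _   | no _
    near i j () | no _    | yes _
    ... | yes xᵢ≤0 | yes _   = <-respʳ-≈ (+-identityˡ r) (+-mono-≤-< xᵢ≤0 (-x<r j))
    ... | no  _    | no xⱼ≰0 = <-respʳ-≈ (+-identityʳ r)
      (+-mono-≤-< (x≤r i) (<-respʳ-≈ -0≈0 (-‿anti-< (≰⇒> xⱼ≰0))))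

  -- The mirror image: r is excluded, and 0 joins the positive members.
  signs-rightOpen : ∀ {r} {I : Set} {x : I → Carrier} →
                    (∀ i → x i < r) → (∀ i → - x i ≤ r) → Signs r x
  signs-rightOpen {r} {I} {x} x<r -x≤r = record { sign = λ i → does (0# ≤? x i) ; near = near }
    where
    near : ∀ i j → does (0# ≤? x i) ≡ does (0# ≤? x j) → x i + - x j < r
    near i j eq with 0# ≤? x i | 0# ≤? x j
    near i j () | yes _   | no _
    near i j () | no _    | yes _
    ... | yes _    | yes 0≤xⱼ = <-respʳ-≈ (+-identityʳ r)
      (+-mono-<-≤ (x<r i) (≤-respʳ-≈ -0≈0 (-‿anti-≤ 0≤xⱼ)))
    ... | no  0≰xᵢ | no _     = <-respʳ-≈ (+-identityˡ r) (+-mono-<-≤ (≰⇒> 0≰xᵢ) (-x≤r j))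

  half : ∃[ h ] 0# < h × h + h ≈ 1#
  half with inverse-pos (+-pos 0<1 0<1)
  ... | h , 0<h , 2h≈1 = h , 0<h , (begin-equality
    h + h            ≈⟨ +-cong (*-identityˡ h) (*-identityˡ h) ⟨
    1# * h + 1# * h  ≈⟨ distribʳ h 1# 1# ⟨
    (1# + 1#) * h    ≈⟨ 2h≈1 ⟩
    1#               ∎)

  private
    h   = proj₁ half
    0<h = proj₁ (proj₂ half)
    2h≈1 = proj₂ (proj₂ half)

  ±½ : Bool → Carrier
  ±½ true  = h
  ±½ false = - h

  h⁻⁻≈h : - - h ≈ h
  h⁻⁻≈h = GroupProperties.⁻¹-involutive +-group h

  ∣±½∣<1 : ∀ b → ∣ ±½ b ∣ < 1#
  ∣±½∣<1 = λ { true → max-< h<1 -h<1 ; false → max-< -h<1 (<-respˡ-≈ (Eq.sym h⁻⁻≈h) h<1) }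
    where
    h<1 : h < 1#
    h<1 = <-respʳ-≈ 2h≈1 (x<x+y h 0<h)
    -h<1 : - h < 1#
    -h<1 = <-trans (<-respʳ-≈ -0≈0 (-‿anti-< 0<h)) 0<1

  ±½-separated : ∀ b c → b ≢ c → 1# ≤ ∣ ±½ b + - ±½ c ∣
  ±½-separated true  true  b≢c = contradiction refl b≢c
  ±½-separated false false b≢c = contradiction refl b≢c
  ±½-separated true  false _   = begin
    1#               ≈⟨ 2h≈1 ⟨
    h + h            ≈⟨ +-congˡ h⁻⁻≈h ⟨
    h + - - h        ≤⟨ x≤x⊔y _ _ ⟩
    ∣ h + - - h ∣    ∎
  ±½-separated false true  _   =
    ≤-respʳ-≈ (∣x-y∣≈∣y-x∣ h (- h)) (±½-separated true false λ ())

  -- Distinct points differ by at least r in some coordinate. Their signs there must differ, so the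
  -- replaced coordinates 1/2 and -1/2 are at distance 1, and P + 1 points form a packing.
  packingNumber-maximal-closed : ∀ {d P r} → IsPackingNumber {d} ℓ∞ P →
    (v : Vector (Vector Carrier d) (suc P)) →
    0# < r → supNorm (v zero) ≈ r → (∀ i → supNorm (v (suc i)) < r) →
    ¬ (∀ {i j} → i ≢ j → r ≤ supNorm (λ k → v i k + - v j k))
  packingNumber-maximal-closed {d} {P} {r} isP v 0<r ‖v₀‖≈r ‖vᵢ‖<r separated =
    ℕ.1+n≰n (IsPackingNumber.maximal isP w isPacking)
    where
    ∣vᵢ∣<r : ∀ i k → ∣ v (suc i) k ∣ < r
    ∣vᵢ∣<r i k = ≤-<-trans (∣x∣≤supNorm (v (suc i)) k) (‖vᵢ‖<r i)

    ∣v∣≤r : ∀ i k → ∣ v i k ∣ ≤ r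
    ∣v∣≤r zero    k = ≤-trans (∣x∣≤supNorm (v zero) k) (≤-reflexive ‖v₀‖≈r)
    ∣v∣≤r (suc i) k = <⇒≤ (∣vᵢ∣<r i k)

    -- Only the point on the sphere can have a coordinate ±r. If its coordinate is ≤ 0, then no
    -- member reaches r; otherwise none reaches -r.
    signs : ∀ k → Signs r (λ i → v i k)
    signs k with v zero k ≤? 0#
    ... | yes v₀≤0 = signs-rightOpen
      (λ { zero → ≤-<-trans v₀≤0 0<r ; (suc i) → ≤-<-trans (x≤x⊔y _ _) (∣vᵢ∣<r i k) })
      (λ i → ≤-trans (x≤y⊔x _ _) (∣v∣≤r i k))
    ... | no  v₀≰0 = signs-leftOpen
      (λ { zero    → <-trans (<-respʳ-≈ -0≈0 (-‿anti-< (≰⇒> v₀≰0))) 0<r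
         ; (suc i) → ≤-<-trans (x≤y⊔x _ _) (∣vᵢ∣<r i k) })
      (λ i → ≤-trans (x≤x⊔y _ _) (∣v∣≤r i k))

    w : Vector (Vector Carrier d) (suc P)
    w i k = ±½ (Signs.sign (signs k) i)

    isPacking : IsPacking ℓ∞ w
    isPacking = record
      { inOpenBall = λ i → supNorm-< (w i) 0<1 (λ k → ∣±½∣<1 (Signs.sign (signs k) i))
      ; separated  = λ {i} {j} i≢j →
          let k , r≤∣vᵢ-vⱼ∣ = ≤-supNorm (λ k → v i k + - v j k) 0<r (separated i≢j) in
          ≤-trans
            (±½-separated _ _ (λ eq → <⇒≱ (Signs.near-abs (signs k) i j eq) r≤∣vᵢ-vⱼ∣))
            (∣x∣≤supNorm (λ k → w i k + - w j k) k)
      }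

-- A common interface to the two kinds of norm.

module Norm (ℝ : CompleteOrderedField) {d : ℕ} where

  open Geometry ℝ
  open OrderedField ℝ using (0#; _≈_; _≤_; _<_)
  open Space {d} using (norm) renaming (Carrier to Vec)
  private
    module _ (V : AmbientSpace d) where
      open AbelianGroup (Space.group V) public using () renaming (_≈_ to infix 4 _≋_)
      open Group (AbelianGroup.group (Space.group V)) public using (_//_)

  norm-cong : ∀ V {v w} → _≋_ V v w → norm V v ≈ norm V w
  norm-cong ℓ∞                 = SupNorm.supNorm-cong ℝ
  norm-cong (innerProduct E _) = InnerProduct.‖‖-cong ℝ E

  norm-sym : ∀ V v w → norm V (_//_ V v w) ≈ norm V (_//_ V w v)
  norm-sym ℓ∞                 = SupNorm.supNorm-sym ℝ
  norm-sym (innerProduct E _) = InnerProduct.‖v//w‖≈‖w//v‖ ℝ E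

  packingNumber-maximal-closed : ∀ V {P r} → IsPackingNumber V P → (v : Vector (Vec V) (suc P)) →
    0# < r → norm V (v zero) ≈ r → (∀ i → norm V (v (suc i)) < r) →
    ¬ (∀ {i j} → i ≢ j → r ≤ norm V (_//_ V (v i) (v j)))
  packingNumber-maximal-closed ℓ∞                   = SupNorm.packingNumber-maximal-closed ℝ
  packingNumber-maximal-closed (innerProduct E dim) = InnerProduct.packingNumber-maximal-closed ℝ E dim

-- Differences in the ultrametric group.

module Ultrametric (ℝ : CompleteOrderedField) {u ℓ} (U : Geometry.UltrametricGroup ℝ u ℓ) where

  open OrderedField ℝ using (max; _≤_; _<_; module Eq; ≤-<-trans; ≤-respˡ-≈; ≤-respʳ-≈; ⊔-cong; max-<)
    renaming (_≈_ to _≈ᵣ_)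
  open Geometry.UltrametricGroup U renaming (refl to ≈-refl; sym to ≈-sym)
  open Group group using (_//_)
  open IsGeneralMetric isUltrametric using (triangle) renaming (sym to dist-sym; cong to dist-cong)

  ∣∣-cong : ∀ {x y} → x ≈ y → ∣ x ∣ ≈ᵣ ∣ y ∣
  ∣∣-cong x≈y = dist-cong x≈y ≈-refl

  -- Translation by y turns |x - y| into the distance from x to y, and the strong triangle
  -- inequality is applied through `ε`.
  ∣x//y∣≤ : ∀ x y → ∣ x // y ∣ ≤ max ∣ x ∣ ∣ y ∣
  ∣x//y∣≤ x y = ≤-respˡ-≈ (Eq.sym ∣x//y∣≈dist)
    (≤-respʳ-≈ (⊔-cong Eq.refl (dist-sym ε y)) (triangle x ε y))
    where
    ∣x//y∣≈dist : ∣ x // y ∣ ≈ᵣ dist x y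
    ∣x//y∣≈dist = Eq.trans (dist-cong ≈-refl (≈-sym (inverseʳ y))) translationInvariant

  ∣x//y∣< : ∀ {r} x y → ∣ x ∣ < r → ∣ y ∣ < r → ∣ x // y ∣ < r
  ∣x//y∣< x y ∣x∣<r ∣y∣<r = ≤-<-trans (∣x//y∣≤ x y) (max-< ∣x∣<r ∣y∣<r)

-- Coset representatives and best returns in the quotient.

module Returns (ℝ : CompleteOrderedField) {d u ℓ p}
               (V : Geometry.AmbientSpace ℝ d) (U : Geometry.UltrametricGroup ℝ u ℓ)
               {Λ : Pred (AbelianGroup.Carrier (Geometry.Product.group ℝ V U)) p}
               (isSubgroup : IsSubgroup (Geometry.Product.group ℝ V U) Λ) where

  open Geometry ℝ
  open Quotient V U isSubgroup
  open OrderedField ℝ using (_≤_; _<_; ≤-refl; ≤-trans; ≤-reflexive; <⇒≤; <⇒≱; <-trans; ≮⇒≥; ⊔-cong)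
    renaming (_≈_ to _≈ᵣ_)
  open Product V U using (∣_∣)
  private
    module G = AbelianGroup (Product.group V U)
    module Λ = IsSubgroup isSubgroup
  open Group G.group using (_//_)
  open AbelianGroupProperties (Product.group V U) using (xyx⁻¹≈y; ⁻¹-anti-homo‿-)
  open GroupProperties X.group using (ε⁻¹≈ε; //-rightDividesʳ)

  ∣∣-cong : ∀ {a b} → a G.≈ b → ∣ a ∣ ≈ᵣ ∣ b ∣
  ∣∣-cong (v≈w , x≈y) = ⊔-cong (Norm.norm-cong ℝ V v≈w) (Ultrametric.∣∣-cong ℝ U x≈y)

  a//[a//b]≈b : ∀ a b → a // (a // b) G.≈ b
  a//[a//b]≈b a b = G.trans (G.∙-congˡ (⁻¹-anti-homo‿- a b))
    (G.trans (G.sym (G.assoc a b (a G.⁻¹))) (xyx⁻¹≈y a b))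

  x-0≈x : ∀ x → (x X.∙ X.ε X.⁻¹) X.≈ x
  x-0≈x x = X.trans (X.∙-congˡ {x} ε⁻¹≈ε) (X.identityʳ x)

  module _ (α : X.Carrier) where

    -- With a representing mα, the element a - e lies in Λ, so |e| = |a - (a - e)| is among the
    -- values whose infimum is `ρ α m`.
    ρ≤∣representative∣ : ∀ m {e} → e X.≈ (m · α) → ρ α m ≤ ∣ e ∣
    ρ≤∣representative∣ m {e} e≈mα = ≤-trans
      (proj₁ (CompleteOrderedField.inf-isInfimum ℝ (Distances a) _ _)
        (a // e , X.trans (x-0≈x (m · α)) (X.sym e≈mα) , refl))
      (≤-reflexive (∣∣-cong (a//[a//b]≈b a e)))
      where a = (m · α) X.∙ X.ε X.⁻¹

    -- The infimum need not be known to be attained, hence the double negation.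
    representative : ∀ m {c} → ρ α m < c → ¬ ¬ (∃[ e ] e X.≈ (m · α) × ∣ e ∣ < c)
    representative m ρ<c none =
      <⇒≱ ρ<c (proj₂ (CompleteOrderedField.inf-isInfimum ℝ (Distances a) _ _) lowerBound)
      where
      a = (m · α) X.∙ X.ε X.⁻¹
      a//l≈mα : ∀ {l} → Λ l → (a // l) X.≈ (m · α)
      a//l≈mα {l} l∈Λ = X.trans
        (Λ.resp (G.sym (xyx⁻¹≈y a (l G.⁻¹))) (Λ.⁻¹-closed l∈Λ)) (x-0≈x (m · α))
      -- Each a - l represents mα, so without a representative of size below c, the number c would
      -- be a lower bound and hence at most the infimum.
      lowerBound : ∀ {x} → Distances a x → _ ≤ x
      lowerBound (l , l∈Λ , refl) = ≮⇒≥ λ ∣a//l∣<c → none (a // l , a//l≈mα l∈Λ , ∣a//l∣<c)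

    -- Writing the larger multiple as `m ℕ.+ k` avoids truncated subtraction.
    difference : ∀ m k {e f} → e X.≈ ((m ℕ.+ k) · α) → f X.≈ (k · α) → (e // f) X.≈ (m · α)
    difference m k e≈ f≈ = X.trans (X.∙-cong (X.trans e≈ (×-homo-+ α m k)) (X.⁻¹-cong f≈))
      (//-rightDividesʳ (k · α) (m · α))
      where open MonoidMult X.monoid using (×-homo-+)

    module _ {N q} (best : AreBestReturns α N q) where
      open AreBestReturns best

      records-monotone : ∀ {i j} → 1 ℕ.≤ i → i ℕ.< j → j ℕ.≤ N → q i ℕ.< q j × ρ α (q j) < ρ α (q i)
      records-monotone {i} {suc j} 1≤i i<1+j j<N with ℕ.m<1+n⇒m<n∨m≡n i<1+j
      ... | inj₂ refl = proj₁ (next 1≤i j<N)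
      ... | inj₁ i<j  =
        let qi<qj , ρj<ρi = records-monotone 1≤i i<j (ℕ.<⇒≤ j<N)
            qj<qj+ , ρj+<ρj = proj₁ (next (ℕ.≤-trans 1≤i (ℕ.<⇒≤ i<j)) j<N)
        in ℕ.<-trans qi<qj qj<qj+ , <-trans ρj+<ρj ρj<ρi

      -- Induction on k. A return time m beyond `q k` with a smaller distance would contradict the
      -- choice of the next record; for m below `q k` the earlier record already bounds `ρ α m`, and
      -- records decrease. At k = 1 no positive m lies below `q 1` = 1.
      ρ-record-minimal : ∀ {k} → 1 ℕ.≤ k → k ℕ.< N → ∀ {m} → 1 ℕ.≤ m → m ℕ.< q (suc k) →
                         ρ α (q k) ≤ ρ α m
      ρ-record-minimal {suc k} 1≤k k<N {m} 1≤m m<q with ℕ.<-cmp m (q (suc k))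
      ... | tri≈ _ refl _ = ≤-refl
      ... | tri> _ _ q<m = ≮⇒≥ λ ρm<ρq →
        ℕ.<⇒≱ m<q (proj₂ (next 1≤k k<N) m (q<m , ρm<ρq))
      ρ-record-minimal {1} _ _ 1≤m _ | tri< m<q₁ _ _ =
        contradiction 1≤m (ℕ.<⇒≱ (≡.subst (_ ℕ.<_) first m<q₁))
      ρ-record-minimal {suc (suc k)} 1≤k k<N 1≤m _ | tri< m<q _ _ = ≤-trans
        (<⇒≤ (proj₂ (records-monotone (ℕ.s≤s ℕ.z≤n) (ℕ.n<1+n (suc k)) (ℕ.<⇒≤ k<N))))
        (ρ-record-minimal (ℕ.s≤s ℕ.z≤n) (ℕ.<⇒≤ k<N) 1≤m m<q)

-- The lower bound for the best-return denominator.

open import Data.Nat.Base using (_+_; _≤_)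

proposition3 : ∀ {u ℓ p} (ℝ : CompleteOrderedField) →
    let open Geometry ℝ in
    (d : ℕ) → 1 ≤ d →
    (V : AmbientSpace d) (U : UltrametricGroup u ℓ)
    (Λ : Pred (AbelianGroup.Carrier (Product.group V U)) p)
    (isSubgroup : IsSubgroup (Product.group V U) Λ) →
    Product.IsClosed V U Λ →
    let open Quotient V U isSubgroup in
    (α : X.Carrier)
    (P : ℕ) → IsPackingNumber V P →
    (n : ℕ) → 1 ≤ n →
    (q : ℕ → ℕ) → AreBestReturns α (n + P) q →
    (v₀ : Space.Carrier V) (u₀ : UltrametricGroup.Carrier U) →
    (v₀ , u₀) X.≈ (q n · α) →
    ℝ.max (Space.norm V v₀) (UltrametricGroup.∣_∣ U u₀) ℝ.≈ ρ α (q n) →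
    UltrametricGroup.∣_∣ U u₀ ℝ.< ρ α (q n) →
    q (n + P) ≥ q n + q (suc n)
proposition3 ℝ d _ V U Λ isSubgroup _ α P isP n 1≤n q best v₀ u₀ e₀≈qₙα ∣e₀∣≈r ∣u₀∣<r =
  -- The order on the natural numbers is decidable, so the goal may be refuted by contradiction, and
  -- representatives known only up to double negation suffice.
  ℕ.≮⇒≥ λ q<q+q → ¬¬-representatives λ reps → impossible q<q+q reps
  where
  open Geometry ℝ
  open Quotient V U isSubgroup
  open Product V U using (∣_∣)
  module U = UltrametricGroup U
  open OrderedField ℝ
    using (x≤y⊔x; x≤x⊔y; ≤-max; ≤-trans; ≤-reflexive; ≤-antisym; ≤-respʳ-≈
          ; ≤-<-trans; <⇒≱; module Eq)
    renaming (_≈_ to _≈ᵣ_; _≤_ to _≤ᵣ_; _<_ to _<ᵣ_)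
  open Returns ℝ V U isSubgroup
  open Group (AbelianGroup.group (Product.group V U)) using (Carrier)
  open Group (AbelianGroup.group (Space.group V)) using () renaming (_//_ to _//ᵥ_)

  r = ρ α (q n)

  Representative : Fin P → Carrier → Set _
  Representative i e = e X.≈ (q (n + suc (toℕ i)) · α) × ∣ e ∣ <ᵣ r

  ¬¬-representatives : ¬ ¬ (∀ i → ∃ (Representative i))
  -- Double negation commutes with a finite product, which gives all P representatives at once.
  ¬¬-representatives = Fin.sequence (RawMonad.rawApplicative ¬¬-Monad) λ i →
    representative α (q (n + suc (toℕ i))) (proj₂ (records-monotone α best 1≤n
      (ℕ.m<m+n n (ℕ.s≤s ℕ.z≤n)) (ℕ.+-monoʳ-≤ n (Fin.toℕ<n i))))

  impossible : q (n + P) ℕ.< q n + q (suc n) → ¬ (∀ i → ∃ (Representative i))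
  impossible q<q+q reps = Norm.packingNumber-maximal-closed ℝ V isP (λ i → proj₁ (e i))
    (≤-<-trans (U.∣∣-nonNeg u₀) ∣u₀∣<r) ‖v₀‖≈r
    (λ i → ≤-<-trans (x≤x⊔y _ _) (proj₂ (proj₂ (reps i)))) separated
    where
    e : Fin (suc P) → Carrier
    e zero    = v₀ , u₀
    e (suc i) = proj₁ (reps i)

    e≈ : ∀ i → e i X.≈ (q (n + toℕ i) · α)
    e≈ zero    = ≡.subst (λ m → e zero X.≈ (q m · α)) (sym (ℕ.+-identityʳ n)) e₀≈qₙα
    e≈ (suc i) = proj₁ (proj₂ (reps i))

    ∣uᵢ∣<r : ∀ i → U.∣ proj₂ (e i) ∣ <ᵣ r
    ∣uᵢ∣<r zero    = ∣u₀∣<r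
    ∣uᵢ∣<r (suc i) = ≤-<-trans (x≤y⊔x (Space.norm V (proj₁ (e (suc i)))) _) (proj₂ (proj₂ (reps i)))

    -- The maximum of the two components is r and the U-component falls short of it, so the
    -- V-component attains it.
    ‖v₀‖≈r : Space.norm V v₀ ≈ᵣ r
    ‖v₀‖≈r = ≤-antisym (≤-trans (x≤x⊔y _ _) (≤-reflexive ∣e₀∣≈r))
      ([ id , (λ r≤∣u₀∣ → contradiction r≤∣u₀∣ (<⇒≱ ∣u₀∣<r)) ]′
        (≤-max (≤-reflexive (Eq.sym ∣e₀∣≈r))))

    n+i≤n+P : ∀ (i : Fin (suc P)) → n + toℕ i ≤ n + P
    n+i≤n+P i = ℕ.+-monoʳ-≤ n (Fin.toℕ≤pred[n] i)

    qₙ≤q : ∀ i → q n ≤ q (n + toℕ i)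
    qₙ≤q zero      = ℕ.≤-reflexive (≡.cong q (sym (ℕ.+-identityʳ n)))
    qₙ≤q i@(suc _) =
      ℕ.<⇒≤ (proj₁ (records-monotone α best 1≤n (ℕ.m<m+n n (ℕ.s≤s ℕ.z≤n)) (n+i≤n+P i)))

    separated-< : ∀ i j → toℕ i ℕ.< toℕ j → r ≤ᵣ Space.norm V (proj₁ (e j) //ᵥ proj₁ (e i))
    separated-< i j i<j =
      [ id
      , (λ r≤∣uⱼ-uᵢ∣ → contradiction r≤∣uⱼ-uᵢ∣
          (<⇒≱ (Ultrametric.∣x//y∣< ℝ U _ _ (∣uᵢ∣<r j) (∣uᵢ∣<r i)))) ]′
      -- `e j` - `e i` represents mα, so its size is at least r; one of its components has that
      -- size, and the ultrametric bound rules out the U-component.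
      (≤-max (≤-trans (ρ-record-minimal α best 1≤n n<n+P 1≤m m<qₙ₊₁)
        (ρ≤∣representative∣ α m (difference α m qᵢ
          (≡.subst (λ k → e j X.≈ (k · α)) (sym m+qᵢ≡qⱼ) (e≈ j)) (e≈ i)))))
      where
      qᵢ = q (n + toℕ i)
      qⱼ = q (n + toℕ j)
      m  = qⱼ ℕ.∸ qᵢ

      -- Two indices i < j exist only when P is positive; this makes `q (suc n)` one of the known
      -- records.
      n<n+P : n ℕ.< n + P
      n<n+P = ℕ.<-≤-trans (ℕ.m<m+n n (ℕ.≤-<-trans ℕ.z≤n i<j)) (n+i≤n+P j)

      qᵢ<qⱼ : qᵢ ℕ.< qⱼ
      qᵢ<qⱼ = proj₁ (records-monotone α best (ℕ.≤-trans 1≤n (ℕ.m≤m+n n _))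
        (ℕ.+-monoʳ-< n i<j) (n+i≤n+P j))

      m+qᵢ≡qⱼ : m + qᵢ ≡ qⱼ
      m+qᵢ≡qⱼ = ℕ.m∸n+n≡m (ℕ.<⇒≤ qᵢ<qⱼ)

      1≤m : 1 ≤ m
      1≤m = ℕ.m<n⇒0<n∸m qᵢ<qⱼ

      qⱼ≤qₙ₊ₚ : qⱼ ≤ q (n + P)
      qⱼ≤qₙ₊ₚ with ℕ.m≤n⇒m<n∨m≡n (n+i≤n+P j)
      ... | inj₁ n+j<n+P = ℕ.<⇒≤ (proj₁ (records-monotone α best
        (ℕ.≤-trans 1≤n (ℕ.m≤m+n n _)) n+j<n+P ℕ.≤-refl))
      ... | inj₂ n+j≡n+P = ℕ.≤-reflexive (≡.cong q n+j≡n+P)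

      m<qₙ₊₁ : m ℕ.< q (suc n)
      -- The assumption to be refuted enters here: qᵢ is added to both sides and its bound `q n` ≤
      -- qᵢ absorbs the first summand.
      m<qₙ₊₁ = ℕ.+-cancelʳ-< qᵢ m (q (suc n)) (begin-strict
        m + qᵢ           ≡⟨ m+qᵢ≡qⱼ ⟩
        qⱼ               ≤⟨ qⱼ≤qₙ₊ₚ ⟩
        q (n + P)        <⟨ q<q+q ⟩
        q n + q (suc n)  ≤⟨ ℕ.+-monoˡ-≤ (q (suc n)) (qₙ≤q i) ⟩
        qᵢ + q (suc n)   ≡⟨ ℕ.+-comm qᵢ (q (suc n)) ⟩
        q (suc n) + qᵢ   ∎)
        where open ℕ.≤-Reasoning

    separated : ∀ {i j} → i ≢ j → r ≤ᵣ Space.norm V (proj₁ (e i) //ᵥ proj₁ (e j))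
    separated {i} {j} i≢j with ℕ.<-cmp (toℕ i) (toℕ j)
    ... | tri< i<j _ _ = ≤-respʳ-≈ (Norm.norm-sym ℝ V _ _) (separated-< i j i<j)
    ... | tri≈ _ i≡j _ = contradiction (Fin.toℕ-injective i≡j) i≢j
    ... | tri> _ _ j<i = separated-< j i j<i
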